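{- Let $(X,\mathcal{F})$ be a well-graded family. Then $$|ess_{\mathcal{F}}(X)|+1\le|\mathcal{F}|\le|E(G_{\mathcal{F}})|+1.$$
   Context: A set system $(X,\mathcal{F})$ is a finite set $X$ together with a nonempty family $\mathcal{F}$ of distinct subsets of $X$. Its one-inclusion graph $G_{\mathcal{F}}$ has a vertex $v_A$ for each $A\in\mathcal{F}$, with an edge (directed from $v_A$ to $v_B$, labelled $b$) whenever $B=A\cup\{b\}$ for some $b\in X\setminus A$; $E(G_{\mathcal{F}})$ is its edge set. The system is a well-graded family if for all $A,B\in\mathcal{F}$ the distance between $v_A$ and $v_B$ in the underlying undirected graph of $G_{\mathcal{F}}$ equals $|A\triangle B|$ (infinite distance if there is no path). $ess_{\mathcal{F}}(X)$ is the set of $x\in X$ for which there are $A,B\in\mathcal{F}$ with $x\in A$ and $x\notin B$. -}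

module Defs where

open import Data.Fin.Base using (Fin)
open import Data.Fin.Subset using (Subset; _∈_; _∉_; _∪_; _─_; ⁅_⁆; ∣_∣)
open import Data.Fin.Subset.Properties using (_∈?_)
open import Data.List.Base using (List; []; filter; cartesianProduct; allFin)
open import Data.List.Membership.Propositional using (find; lose) renaming (_∈_ to _∈ₗ_)
open import Data.List.Relation.Unary.Any using (any?)
open import Data.List.Relation.Unary.Unique.Propositional using (Unique)
open import Data.List.Relation.Unary.Unique.Propositional.Properties
  using (filter⁺; cartesianProduct⁺; allFin⁺)
open import Data.Bool.Properties using () renaming (_≟_ to _≟ᵇ_)
open import Data.Nat.Base using (ℕ; zero; suc; _≤_)
open import Data.Product.Base using (_×_; _,_; ∃; ∃₂)
open import Data.Vec.Base using (tabulate)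
open import Data.Vec.Properties using (≡-dec)
open import Relation.Binary.Construct.Closure.Symmetric using (SymClosure)
open import Relation.Binary.Core using (Rel)
open import Relation.Binary.PropositionalEquality using (_≡_; _≢_)
open import Relation.Nullary.Decidable using (does; map′; _×-dec_; ¬?)
open import Level using (0ℓ)
open import Relation.Unary using (Decidable)

infixl 6 _△_

_△_ : ∀ {n} → Subset n → Subset n → Subset n
A △ B = (A ─ B) ∪ (B ─ A)

-- The ground set is Fin n.  The family is listed without repetition, so
-- that its cardinality is the length of the list.
record SetSystem (n : ℕ) : Set where
  field
    family   : List (Subset n)
    distinct : Unique family
    nonempty : family ≢ []

-- The triple (A , b , B) stands for an arrow from A to B labelled b.
LabelledPair : ℕ → Set
LabelledPair n = Subset n × Fin n × Subset n

AddsLabel : ∀ {n} → LabelledPair n → Set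
AddsLabel (A , b , B) = b ∉ A × B ≡ A ∪ ⁅ b ⁆

addsLabel? : ∀ {n} → Decidable (AddsLabel {n})
addsLabel? (A , b , B) = ¬? (b ∈? A) ×-dec ≡-dec _≟ᵇ_ B (A ∪ ⁅ b ⁆)

data Walk {V : Set} (_~_ : Rel V 0ℓ) : V → V → ℕ → Set where
  nil  : ∀ {u} → Walk _~_ u u zero
  cons : ∀ {u v w k} → u ~ v → Walk _~_ v w k → Walk _~_ u w (suc k)

-- In particular the distance d is finite.
IsDistance : {V : Set} → Rel V 0ℓ → V → V → ℕ → Set
IsDistance _~_ u v d = Walk _~_ u v d × (∀ k → Walk _~_ u v k → d ≤ k)

module _ {n : ℕ} (S : SetSystem n) where
  open SetSystem S

  -- The vertex v_A of the one-inclusion graph is represented by A itself.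
  edges : List (LabelledPair n)
  edges = filter addsLabel? (cartesianProduct family (cartesianProduct (allFin n) family))

  -- Hence the number of edges is the length of the list.
  edges-unique : Unique edges
  edges-unique = filter⁺ addsLabel?
    (cartesianProduct⁺ distinct (cartesianProduct⁺ (allFin⁺ n) distinct))

  Arrow : Rel (Subset n) 0ℓ
  Arrow A B = ∃ λ b → (A , b , B) ∈ₗ edges

  Adjacent : Rel (Subset n) 0ℓ
  Adjacent = SymClosure Arrow

  WellGraded : Set
  WellGraded = ∀ {A B} → A ∈ₗ family → B ∈ₗ family →
    IsDistance Adjacent A B ∣ A △ B ∣

  Essential : Fin n → Set
  Essential x = ∃₂ λ A B → A ∈ₗ family × B ∈ₗ family × x ∈ A × x ∉ B

  essential? : Decidable Essential
  essential? x = map′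
    (λ (p , q) → let (A , A∈ , x∈A) = find p ; (B , B∈ , x∉B) = find q
                 in A , B , A∈ , B∈ , x∈A , x∉B)
    (λ (_ , _ , A∈ , B∈ , x∈A , x∉B) → lose A∈ x∈A , lose B∈ x∉B)
    (any? (λ A → x ∈? A) family ×-dec any? (λ B → ¬? (x ∈? B)) family)

  ess : Subset n
  ess = tabulate λ x → does (essential? x)

{-# OPTIONS --safe #-}
-- Fix a member R of the family. A shortest walk from any other member A to R
-- starts with an edge to a member (the parent of A) that is strictly closer to
-- R. The edge to the parent determines A as its endpoint farther from R, so
-- there are at least |F| − 1 edges. An essential x separates R from some
-- member; on the way from there to R along parents x must be crossed, so every
-- essential x is the label of one of at most |F| − 1 parent edges.
module Submission where

open import Defs
open import Data.Bool.Base using (true; false; if_then_else_; _∨_)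
open import Data.Bool.Properties using (∨-identityʳ)
open import Data.Fin.Base using (Fin; zero; suc)
open import Data.Fin.Properties using (_≟_; injective⇒≤)
open import Data.Fin.Subset using (Subset; _∈_; _∉_; _⊆_; _∪_; ⁅_⁆; ⋃; ∣_∣)
open import Data.Fin.Subset.Properties
  using (x∈⁅x⁆; x∈⁅y⁆⇒x≡y; ∣⁅x⁆∣≡1; ∣⊥∣≡0; p⊆q⇒∣p∣≤∣q∣; x∈p∪q⁺)
open import Data.List.Base using (List; []; _∷_; allFin; length; lookup; map)
open import Data.List.Membership.Propositional using (mapWith∈) renaming (_∈_ to _∈ₗ_)
open import Data.List.Membership.Propositional.Properties
  using (∈-lookup; ∈-map⁺; ∈-filter⁻; ∈-cartesianProduct⁻)
open import Data.List.Membership.Setoid.Properties using (index-injective; length-mapWith∈)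
open import Data.List.Properties using (length-map)
open import Data.List.Relation.Binary.Subset.Propositional using () renaming (_⊆_ to _⊆ₗ_)
import Data.List.Relation.Unary.All as All
open import Data.List.Relation.Unary.AllPairs as AllPairs using (_∷_)
open import Data.List.Relation.Unary.Any using (here; there; index)
open import Data.List.Relation.Unary.Any.Properties using (mapWith∈⁺)
open import Data.List.Relation.Unary.Unique.Propositional using (Unique)
open import Data.Nat.Base using (ℕ; suc; _+_; _≤_; _<_; z≤n; s≤s)
open import Data.Nat.Induction using (<-wellFounded)
open import Data.Nat.Properties
  using (_<?_; <-asym; +-comm; +-suc; m≤n⇒m≤1+n; ≤-reflexive; module ≤-Reasoning)
open import Data.Product.Base using (_×_; _,_; ∃; ∃₂; proj₁; proj₂)
open import Data.Sum.Base using (inj₁; inj₂)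
import Data.Vec.Base as Vec
open import Data.Vec.Properties using ([]=⇒lookup; lookup⇒[]=; lookup∘tabulate; lookup-zipWith)
open import Function.Base using (_∘_)
open import Function.Definitions using (Injective)
open import Induction.WellFounded using (Acc; acc)
open import Relation.Binary.Construct.Closure.Symmetric using (fwd; bwd)
open import Relation.Binary.PropositionalEquality
  using (_≡_; _≢_; refl; sym; trans; cong; subst; setoid)
open import Relation.Nullary using (Dec; yes; no; contradiction)
open import Relation.Nullary.Decidable using (does; dec-true; dec-false)

does≡true⇒ : ∀ {P : Set} (P? : Dec P) → does P? ≡ true → P
does≡true⇒ (yes p) _ = p

lookup-injective : ∀ {A : Set} {xs : List A} → Unique xs → Injective _≡_ _≡_ (lookup xs)
lookup-injective (_  ∷ _) {zero}  {zero}  _  = refl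
lookup-injective (x∉ ∷ _) {zero}  {suc j} eq = contradiction eq (All.lookup x∉ (∈-lookup j))
lookup-injective (x∉ ∷ _) {suc i} {zero}  eq = contradiction (sym eq) (All.lookup x∉ (∈-lookup i))
lookup-injective (_  ∷ u) {suc i} {suc j} eq = cong suc (lookup-injective u eq)

-- Each position of `xs` goes to the position in `ys` where its entry is found. Equal positions in
-- `ys` force equal entries, and `xs` repeats none, so this map is injective.
Unique-⊆⇒length≤ : ∀ {A : Set} {xs ys : List A} → Unique xs → xs ⊆ₗ ys → length xs ≤ length ys
Unique-⊆⇒length≤ {A} u xs⊆ys = injective⇒≤ {f = λ i → index (xs⊆ys (∈-lookup i))}
  (λ {i} {j} eq → lookup-injective u (index-injective (setoid A) (xs⊆ys (∈-lookup i)) (xs⊆ys (∈-lookup j)) eq))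

∣p∪q∣≤∣p∣+∣q∣ : ∀ {n} (p q : Subset n) → ∣ p ∪ q ∣ ≤ ∣ p ∣ + ∣ q ∣
∣p∪q∣≤∣p∣+∣q∣ Vec.[]            Vec.[]            = z≤n
∣p∪q∣≤∣p∣+∣q∣ (true  Vec.∷ p) (true  Vec.∷ q) rewrite +-suc ∣ p ∣ ∣ q ∣ = s≤s (m≤n⇒m≤1+n (∣p∪q∣≤∣p∣+∣q∣ p q))
∣p∪q∣≤∣p∣+∣q∣ (true  Vec.∷ p) (false Vec.∷ q) = s≤s (∣p∪q∣≤∣p∣+∣q∣ p q)
∣p∪q∣≤∣p∣+∣q∣ (false Vec.∷ p) (true  Vec.∷ q) rewrite +-suc ∣ p ∣ ∣ q ∣ = s≤s (∣p∪q∣≤∣p∣+∣q∣ p q)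
∣p∪q∣≤∣p∣+∣q∣ (false Vec.∷ p) (false Vec.∷ q) = ∣p∪q∣≤∣p∣+∣q∣ p q

fromList : ∀ {n} → List (Fin n) → Subset n
fromList xs = ⋃ (map ⁅_⁆ xs)

∈-fromList⁺ : ∀ {n} {x : Fin n} {xs} → x ∈ₗ xs → x ∈ fromList xs
∈-fromList⁺ (here refl) = x∈p∪q⁺ (inj₁ (x∈⁅x⁆ _))
∈-fromList⁺ (there x∈)  = x∈p∪q⁺ (inj₂ (∈-fromList⁺ x∈))

∣fromList∣≤length : ∀ {n} (xs : List (Fin n)) → ∣ fromList xs ∣ ≤ length xs
∣fromList∣≤length {n} []       = ≤-reflexive (∣⊥∣≡0 n)
∣fromList∣≤length     (x ∷ xs) = begin
  ∣ ⁅ x ⁆ ∪ fromList xs ∣       ≤⟨ ∣p∪q∣≤∣p∣+∣q∣ ⁅ x ⁆ (fromList xs) ⟩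
  ∣ ⁅ x ⁆ ∣ + ∣ fromList xs ∣   ≡⟨ cong (_+ ∣ fromList xs ∣) (∣⁅x⁆∣≡1 x) ⟩
  suc ∣ fromList xs ∣           ≤⟨ s≤s (∣fromList∣≤length xs) ⟩
  suc (length xs)               ∎
  where open ≤-Reasoning

∉⇒lookup≡false : ∀ {n} {x : Fin n} {p : Subset n} → x ∉ p → Vec.lookup p x ≡ false
∉⇒lookup≡false {x = x} {p} x∉p with Vec.lookup p x in eq
... | true  = contradiction (lookup⇒[]= x p eq) x∉p
... | false = refl

lookup-∪⁅⁆ : ∀ {n} {x b : Fin n} (p : Subset n) → x ≢ b →
  Vec.lookup (p ∪ ⁅ b ⁆) x ≡ Vec.lookup p x
lookup-∪⁅⁆ {x = x} {b} p x≢b = trans (lookup-zipWith _∨_ x p ⁅ b ⁆)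
  (trans (cong (Vec.lookup p x ∨_) (∉⇒lookup≡false (x≢b ∘ x∈⁅y⁆⇒x≡y b))) (∨-identityʳ _))

module _ {n : ℕ} (S : SetSystem n) where
  open SetSystem S

  ∈-edges⁻ : ∀ {A b B} → (A , b , B) ∈ₗ edges S → A ∈ₗ family × B ∈ₗ family × AddsLabel (A , b , B)
  ∈-edges⁻ e with e∈ , adds ← ∈-filter⁻ addsLabel? e
             with A∈ , bB∈ ← ∈-cartesianProduct⁻ family _ e∈
    = A∈ , proj₂ (∈-cartesianProduct⁻ (allFin n) family bB∈) , adds

  label : ∀ {A B} → Adjacent S A B → Fin n
  label (fwd (b , _)) = b
  label (bwd (b , _)) = b

  Adjacent⇒∈ʳ : ∀ {A B} → Adjacent S A B → B ∈ₗ family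
  Adjacent⇒∈ʳ (fwd (_ , e)) = proj₁ (proj₂ (∈-edges⁻ e))
  Adjacent⇒∈ʳ (bwd (_ , e)) = proj₁ (∈-edges⁻ e)

  -- One endpoint arises from the other by joining the singleton of the label, which is `false` at
  -- every other coordinate. Comparing Boolean coordinates treats both directions of the edge alike.
  lookup-Adjacent : ∀ {A B x} (e : Adjacent S A B) → x ≢ label e → Vec.lookup A x ≡ Vec.lookup B x
  lookup-Adjacent {A} (fwd (_ , e)) x≢b with _ , _ , _ , refl ← ∈-edges⁻ e = sym (lookup-∪⁅⁆ A x≢b)
  lookup-Adjacent {B = B} (bwd (_ , e)) x≢b with _ , _ , _ , refl ← ∈-edges⁻ e = lookup-∪⁅⁆ B x≢b

  ∈-ess⁻ : ∀ {x} → x ∈ ess S → Essential S x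
  ∈-ess⁻ {x} x∈ = does≡true⇒ (essential? S x)
    (trans (sym (lookup∘tabulate (λ y → does (essential? S y)) x)) ([]=⇒lookup x∈))

  -- The two witnesses of essentiality disagree at `x`, so whichever value `R` takes there, one of
  -- them differs from it.
  Essential⇒separated : ∀ {x} → Essential S x → ∀ R →
    ∃ λ A → A ∈ₗ family × Vec.lookup A x ≢ Vec.lookup R x
  Essential⇒separated {x} (A , B , A∈ , B∈ , x∈A , x∉B) R with Vec.lookup R x
  ... | true  = B , B∈ , λ eq → contradiction (trans (sym eq) (∉⇒lookup≡false x∉B)) λ ()
  ... | false = A , A∈ , λ eq → contradiction (trans (sym ([]=⇒lookup x∈A)) eq) λ ()

  -- Well-gradedness is used twice: for `A` it supplies a walk to `R` of length `∣ A △ R ∣`, and for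
  -- the second vertex of that walk it bounds the distance to `R` by the length of the remaining
  -- walk, which is one less.
  parent : WellGraded S → ∀ {A R} → A ∈ₗ family → R ∈ₗ family → A ≢ R →
    ∃ λ B → Adjacent S A B × ∣ B △ R ∣ < ∣ A △ R ∣
  parent wg {A} {R} A∈ R∈ A≢R = firstStep (proj₁ (wg A∈ R∈))
    where
    firstStep : ∀ {d} → Walk (Adjacent S) A R d → ∃ λ B → Adjacent S A B × ∣ B △ R ∣ < d
    firstStep nil        = contradiction refl A≢R
    firstStep (cons e w) = _ , e , s≤s (proj₂ (wg (Adjacent⇒∈ʳ e) R∈) _ w)

-- Arrows point towards the larger set, not towards `R`, so the distances must be compared. A tie
-- yields `A`, but the ends of a parent edge are never tied.
fartherEnd : ∀ {n} → Subset n → LabelledPair n → Subset n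
fartherEnd R (A , _ , B) = if does (∣ A △ R ∣ <? ∣ B △ R ∣) then B else A

module _ {n : ℕ} {R : Subset n} {Rs : List (Subset n)}
  (distinct : Unique (R ∷ Rs)) (nonempty : R ∷ Rs ≢ []) where

  private
    S : SetSystem n
    S = record { family = R ∷ Rs ; distinct = distinct ; nonempty = nonempty }

  module _ (wg : WellGraded S) where

    parentOf : ∀ {A} → A ∈ₗ Rs → ∃ λ B → Adjacent S A B × ∣ B △ R ∣ < ∣ A △ R ∣
    parentOf A∈ = parent S wg (there A∈) (here refl) (All.lookup (AllPairs.head distinct) A∈ ∘ sym)

    parentLabel : ∀ {A} → A ∈ₗ Rs → Fin n
    parentLabel A∈ = label S (proj₁ (proj₂ (parentOf A∈)))

    -- Recovering each vertex from its parent edge replaces a proof that distinct vertices have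
    -- distinct parent edges: a covering of `Rs` by the image of `edges S` suffices for counting.
    Rs⊆fartherEnds : Rs ⊆ₗ map (fartherEnd R) (edges S)
    Rs⊆fartherEnds {A} A∈ with parentOf A∈
    ... | B , fwd (b , e) , B<A = subst (_∈ₗ _)
      (cong (if_then B else A) (dec-false (∣ A △ R ∣ <? ∣ B △ R ∣) (<-asym B<A)))
      (∈-map⁺ (fartherEnd R) e)
    -- Here the stored triple is `(B , b , A)`, so `A` is its last component and the test succeeds.
    ... | B , bwd (b , e) , B<A = subst (_∈ₗ _)
      (cong (if_then A else B) (dec-true (∣ B △ R ∣ <? ∣ A △ R ∣) B<A))
      (∈-map⁺ (fartherEnd R) e)

    length≤edges : length Rs ≤ length (edges S)
    length≤edges = begin
      length Rs                              ≤⟨ Unique-⊆⇒length≤ (AllPairs.tail distinct) Rs⊆fartherEnds ⟩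
      length (map (fartherEnd R) (edges S))  ≡⟨ length-map (fartherEnd R) (edges S) ⟩
      length (edges S)                       ∎
      where open ≤-Reasoning

    -- The chain of parents ends at `R`, where the value at `x` agrees with that of `R`, so some
    -- parent edge on the way changes coordinate `x`. The chain ends because the distance to `R`
    -- strictly decreases.
    separated⇒parentLabel : ∀ {x A} → A ∈ₗ R ∷ Rs → Vec.lookup A x ≢ Vec.lookup R x →
      ∃₂ λ B (B∈ : B ∈ₗ Rs) → x ≡ parentLabel B∈
    separated⇒parentLabel {x} A∈ = descend A∈ (<-wellFounded _)
      where
      descend : ∀ {A} → A ∈ₗ R ∷ Rs → Acc _<_ ∣ A △ R ∣ → Vec.lookup A x ≢ Vec.lookup R x →
        ∃₂ λ B (B∈ : B ∈ₗ Rs) → x ≡ parentLabel B∈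
      descend (here refl) _         A≢R = contradiction refl A≢R
      descend (there A∈)  (acc rec) A≢R with x ≟ parentLabel A∈
      ... | yes x≡ = _ , A∈ , x≡
      -- An edge with another label preserves coordinate `x`, so the parent still differs from `R`
      -- there. The parent may be `R` itself, which the first clause rules out.
      ... | no  x≢ = let B , e , B<A = parentOf A∈ in
        descend (Adjacent⇒∈ʳ S e) (rec B<A) (A≢R ∘ trans (lookup-Adjacent S e x≢))

    ∣ess∣≤length : ∣ ess S ∣ ≤ length Rs
    ∣ess∣≤length = begin
      ∣ ess S ∣            ≤⟨ p⊆q⇒∣p∣≤∣q∣ ess⊆labels ⟩
      ∣ fromList labels ∣  ≤⟨ ∣fromList∣≤length labels ⟩
      length labels        ≡⟨ length-mapWith∈ (setoid _) Rs ⟩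
      length Rs            ∎
      where
      open ≤-Reasoning
      labels : List (Fin n)
      -- `parentLabel` depends on the membership proof, hence `mapWith∈`. Repeated labels are
      -- harmless, since only an upper bound is wanted.
      labels = mapWith∈ Rs parentLabel
      ess⊆labels : ess S ⊆ fromList labels
      ess⊆labels x∈ with _ , A∈ , A≢R ← Essential⇒separated S (∈-ess⁻ S x∈) R =
        ∈-fromList⁺ (mapWith∈⁺ parentLabel (separated⇒parentLabel A∈ A≢R))

proposition3p1 : ∀ (n : ℕ) (S : SetSystem n) → WellGraded S →
    (∣ ess S ∣ + 1 ≤ length (SetSystem.family S)) × (length (SetSystem.family S) ≤ length (edges S) + 1)
proposition3p1 n record { family = [] ; nonempty = nonempty } wg = contradiction refl nonempty
-- The head of the list serves as the fixed member, so `length Rs` is the size of the family minus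
-- one.
proposition3p1 n S@record { family = R ∷ Rs ; distinct = distinct ; nonempty = nonempty } wg
  rewrite +-comm ∣ ess S ∣ 1 | +-comm (length (edges S)) 1 =
  s≤s (∣ess∣≤length distinct nonempty wg) , s≤s (length≤edges distinct nonempty wg)
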